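{- Let $\lambda>1$ be an ordinal and let $\Omega=\langle \omega^{\omega^\lambda};\times,1,\omega,\omega+1,\omega^2+1\rangle$. For each atomic formula $E(x_1,\dots,x_p)$ of $\langle\mathbb{N};+,\times,0,1\rangle$ (i.e. a Diophantine equation), the relation $$\texttt{EQ}_E=\{((\omega+1)^{j_1},\dots,(\omega+1)^{j_p})\mid j_1,\dots,j_p\in\mathbb{N},\ \langle\mathbb{N};+,\times,0,1\rangle\models E(j_1,\dots,j_p)\}$$ is definable in $\Omega$ by a formula of the form $\exists u_1\cdots\exists u_m\,\forall v_1\cdots\forall v_6\,\varphi$ with $\varphi$ quantifier-free (for some $m$).
   Context: $\Omega$ is the structure with domain the ordinal $\omega^{\omega^\lambda}$, the ordinal multiplication $\times$ and the constants $1,\omega,\omega+1,\omega^2+1$. -}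

module Defs where

open import Level using (0ℓ)
open import Data.Nat using (ℕ; zero; suc; _+_; _*_)
open import Data.Fin using (Fin)
open import Data.List using (List; []; _∷_; foldr)
open import Data.List.Relation.Unary.Linked using (Linked)
open import Data.List.Relation.Unary.All using (All)
open import Data.Product using (Σ; _×_; _,_; proj₁; proj₂)
open import Data.Sum using (_⊎_)
open import Relation.Nullary using (¬_)
open import Relation.Binary using (Rel; IsStrictTotalOrder; tri<; tri≈; tri>)
open import Relation.Binary.PropositionalEquality using (_≡_)
open import Induction.WellFounded using (WellFounded)
open import Data.Vec.Functional using (_++_)
open import Function.Bundles using (_⇔_)

-- An ordinal λ, given as a well-ordered set (strict total order w.r.t. ≡,
-- well-founded).

record WellOrder : Set₁ where
  field
    Carrier : Set
    _<_     : Rel Carrier 0ℓ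
    isSTO   : IsStrictTotalOrder _≡_ _<_
    wf      : WellFounded _<_

data Cmp : Set where
  lt eq gt : Cmp

cmpℕ : ℕ → ℕ → Cmp
cmpℕ zero    zero    = eq
cmpℕ zero    (suc _) = lt
cmpℕ (suc _) zero    = gt
cmpℕ (suc m) (suc n) = cmpℕ m n

-- Cantor normal forms over a key type K: lists of (exponent, coefficient)
-- pairs; a pair (k , c) stands for the term ω^k · (c + 1)  (so coefficients
-- are always ≥ 1).  A well-formed CNF has strictly decreasing exponents.
CNF : Set → Set
CNF K = List (K × ℕ)

-- lexicographic comparison of CNFs (correct on well-formed CNFs)
cmpCNF : {K : Set} → (K → K → Cmp) → CNF K → CNF K → Cmp
cmpCNF cmp []             []             = eq
cmpCNF cmp []             (_ ∷ _)        = lt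
cmpCNF cmp (_ ∷ _)        []             = gt
cmpCNF cmp ((k , c) ∷ xs) ((l , d) ∷ ys) with cmp k l
... | lt = lt
... | gt = gt
... | eq with cmpℕ c d
...   | lt = lt
...   | gt = gt
...   | eq = cmpCNF cmp xs ys

addCNF : {K : Set} → (K → K → Cmp) → CNF K → CNF K → CNF K
addCNF cmp xs [] = xs
addCNF {K} cmp xs ((l , d) ∷ ys) = go xs
  where
  go : CNF K → CNF K
  go [] = (l , d) ∷ ys
  go ((k , c) ∷ xs') with cmp k l
  ... | gt = (k , c) ∷ go xs'
  ... | eq = (l , c + d + 1) ∷ ys
  ... | lt = (l , d) ∷ ys

Decreasing : {K : Set} → (K → K → Cmp) → CNF K → Set
Decreasing cmp = Linked (λ x y → cmp (proj₁ x) (proj₁ y) ≡ gt)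

module Omega (Λ : WellOrder) where
  open WellOrder Λ

  cmpΛ : Carrier → Carrier → Cmp
  cmpΛ x y with IsStrictTotalOrder.compare isSTO x y
  ... | tri< _ _ _ = lt
  ... | tri≈ _ _ _ = eq
  ... | tri> _ _ _ = gt

  -- exponents: ordinals < ω^λ, as CNFs with exponents in λ
  Exp : Set
  Exp = CNF Carrier

  cmpExp : Exp → Exp → Cmp
  cmpExp = cmpCNF cmpΛ

  addExp : Exp → Exp → Exp
  addExp = addCNF cmpΛ

  WFExp : Exp → Set
  WFExp = Decreasing cmpΛ

  -- raw codes of ordinals < ω^(ω^λ)
  Raw : Set
  Raw = CNF Exp

  WF : Raw → Set
  WF α = Decreasing cmpExp α × All (λ t → WFExp (proj₁ t)) α

  Elt : Set
  Elt = Σ Raw WF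

  addRaw : Raw → Raw → Raw
  addRaw = addCNF cmpExp

  -- α · ω^b · (d+1)
  mulTerm : Raw → Exp × ℕ → Raw
  mulTerm []             _             = []
  mulTerm ((a , c) ∷ as) ([] , d)      = (a , c + d + c * d) ∷ as
  mulTerm ((a , c) ∷ as) (b ∷ bs , d)  = (addExp a (b ∷ bs) , d) ∷ []

  -- ordinal multiplication (left distributivity over the CNF of β)
  mulRaw : Raw → Raw → Raw
  mulRaw α β = foldr (λ t acc → addRaw (mulTerm α t) acc) [] β

  -- constants, given the least element z of λ (the ordinal 0 ∈ λ)
  module Consts (z : Carrier) where
    oneR : Raw
    oneR = ([] , 0) ∷ []
    ωR : Raw
    ωR = ((z , 0) ∷ [] , 0) ∷ []
    ω+1R : Raw
    ω+1R = ((z , 0) ∷ [] , 0) ∷ ([] , 0) ∷ []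
    ω²+1R : Raw
    ω²+1R = ((z , 1) ∷ [] , 0) ∷ ([] , 0) ∷ []

    data Term (n : ℕ) : Set where
      var   : Fin n → Term n
      _⊗_   : Term n → Term n → Term n
      c1 cω cω+1 cω²+1 : Term n

    evalT : {n : ℕ} → (Fin n → Raw) → Term n → Raw
    evalT ρ (var i)  = ρ i
    evalT ρ (s ⊗ t)  = mulRaw (evalT ρ s) (evalT ρ t)
    evalT ρ c1       = oneR
    evalT ρ cω       = ωR
    evalT ρ cω+1     = ω+1R
    evalT ρ cω²+1    = ω²+1R

    data QF (n : ℕ) : Set where
      _≐_  : Term n → Term n → QF n
      ¬'_  : QF n → QF n
      _∧'_ : QF n → QF n → QF n
      _∨'_ : QF n → QF n → QF n

    -- satisfaction (equality of canonical codes = equality of ordinals)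
    Sat : {n : ℕ} → (Fin n → Raw) → QF n → Set
    Sat ρ (s ≐ t)  = evalT ρ s ≡ evalT ρ t
    Sat ρ (¬' φ)   = ¬ Sat ρ φ
    Sat ρ (φ ∧' ψ) = Sat ρ φ × Sat ρ ψ
    Sat ρ (φ ∨' ψ) = Sat ρ φ ⊎ Sat ρ ψ

    powRaw : Raw → ℕ → Raw
    powRaw x zero    = oneR
    powRaw x (suc n) = mulRaw (powRaw x n) x

    raw : {n : ℕ} → (Fin n → Elt) → Fin n → Raw
    raw a i = proj₁ (a i)

data NTerm (p : ℕ) : Set where
  var   : Fin p → NTerm p
  _⊕_   : NTerm p → NTerm p → NTerm p
  _⊛_   : NTerm p → NTerm p → NTerm p
  n0 n1 : NTerm p

evalN : {p : ℕ} → (Fin p → ℕ) → NTerm p → ℕ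
evalN j (var i) = j i
evalN j (s ⊕ t) = evalN j s + evalN j t
evalN j (s ⊛ t) = evalN j s * evalN j t
evalN j n0      = 0
evalN j n1      = 1

record Atomic (p : ℕ) : Set where
  constructor _≐ℕ_
  field
    lhs rhs : NTerm p

Holds : {p : ℕ} → Atomic p → (Fin p → ℕ) → Set
Holds (s ≐ℕ t) j = evalN j s ≡ evalN j t

module Definability (Λ : WellOrder) (z : WellOrder.Carrier Λ) where
  open Omega Λ
  open Consts z

  InEQ : {p : ℕ} → Atomic p → (Fin p → Elt) → Set
  InEQ {p} E a = Σ (Fin p → ℕ) λ j →
    ((i : Fin p) → raw a i ≡ powRaw ω+1R (j i)) × Holds E j

  Σ1-∀6-Definable : {p : ℕ} → ((Fin p → Elt) → Set) → Set
  Σ1-∀6-Definable {p} R = Σ ℕ λ m → Σ (QF (p + m + 6)) λ φ →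
    (a : Fin p → Elt) →
      R a ⇔ Σ (Fin m → Elt) λ u → (v : Fin 6 → Elt) →
              Sat ((raw a ++ raw u) ++ raw v) φ

{-# OPTIONS --safe #-}
-- A nonzero ordinal commutes with ω^(n+1)+1 exactly when it is a power of it, and
-- (ω^(n+1)+1)^k has degree k(n+1), which is read off after multiplying by ω from the right.
-- So the powers of ω+1 are quantifier-free definable, multiplying them adds exponents, and
-- their degrees can be compared with those of powers of ω^(n+1)+1, which is itself
-- the only irreducible ordinal ≠ ω of degree n+1. Minimality of a common degree of powers of
-- ω^(i+1)+1 and ω^(i+2)+1 is a universal condition, and this degree is
-- lcm(i+1, i+2) = i² + 3i + 2; hence i ↦ i² is definable, and with addition so is the product.
module Submission where

open import Defs
open import Data.Nat using (ℕ; zero; suc; _+_; _*_; _∸_; _<_; s≤s; z≤n)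
open import Data.Nat.Properties using (*-suc; *-comm; +-cancelʳ-≡; +-cancelˡ-≡; 1+n≢n; m+[n∸m]≡n; *-cancelʳ-≡; *-cancelˡ-≡; m+n≡0⇒m≡0; m+n≡0⇒n≡0; +-identityʳ; *-identityʳ; *-zeroʳ; +-comm; +-assoc; +-suc; *-distribʳ-+; suc-injective; m≤n+m)
open import Data.Nat.Divisibility using (_∣_; divides; quotient; ∣m+n∣m⇒∣n)
open import Data.Nat.Tactic.RingSolver using (solve-∀)
open import Data.List using (List; []; _∷_)
open import Data.List.Properties using (∷-injective; ∷-injectiveˡ; ∷-injectiveʳ)
open import Data.List.Relation.Unary.Linked using ([]; [-]; _∷_)
open import Data.List.Relation.Unary.All using (All; []; _∷_)
open import Data.Product using (Σ; ∃; _×_; _,_; proj₁; proj₂)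
open import Data.Sum using (inj₁; inj₂)
open import Data.Empty using (⊥; ⊥-elim)
open import Function using (case_of_; _∘_)
open import Data.Fin using (Fin; zero; suc; splitAt; _↑ˡ_; _↑ʳ_; #_)
open import Data.Unit using (⊤; tt)
open import Data.Vec using (lookup; []; _∷_)
open import Data.Vec.Functional using (_++_) renaming (_∷_ to _∷ᶠ_)
open import Data.Vec.Functional.Properties using (lookup-++ˡ; lookup-++ʳ)
open import Function.Bundles using (_⇔_; mk⇔; Equivalence)
open import Relation.Nullary using (¬_)
open import Relation.Binary using (IsStrictTotalOrder; tri<; tri≈; tri>)
open import Relation.Binary.PropositionalEquality using (_≡_; _≢_; refl; sym; trans; cong; cong₂; subst; subst₂)

-- Comparison of coefficients, keys and exponents.

cmpℕ-refl : ∀ n → cmpℕ n n ≡ eq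
cmpℕ-refl zero    = refl
cmpℕ-refl (suc n) = cmpℕ-refl n

cmpℕ-eq : ∀ m n → cmpℕ m n ≡ eq → m ≡ n
cmpℕ-eq zero    zero    _ = refl
cmpℕ-eq (suc m) (suc n) e = cong suc (cmpℕ-eq m n e)

<⇒cmpℕ-gt : ∀ {m n} → n < m → cmpℕ m n ≡ gt
<⇒cmpℕ-gt {suc m} {zero}  _       = refl
<⇒cmpℕ-gt {suc m} {suc n} (s≤s l) = <⇒cmpℕ-gt l

cmpℕ-gt⇒< : ∀ m n → cmpℕ m n ≡ gt → n < m
cmpℕ-gt⇒< (suc m) zero    _ = s≤s z≤n
cmpℕ-gt⇒< (suc m) (suc n) e = s≤s (cmpℕ-gt⇒< m n e)

cmpℕ-+ˡ : ∀ c m n → cmpℕ (c + m) (c + n) ≡ cmpℕ m n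
cmpℕ-+ˡ zero    m n = refl
cmpℕ-+ˡ (suc c) m n = cmpℕ-+ˡ c m n

cmpℕ-+ʳ1 : ∀ m n → cmpℕ (m + 1) (n + 1) ≡ cmpℕ m n
cmpℕ-+ʳ1 m n rewrite +-comm m 1 | +-comm n 1 = refl

module _ (Λ : WellOrder) (z : WellOrder.Carrier Λ)
         (z-min : (x : WellOrder.Carrier Λ) → ¬ WellOrder._<_ Λ x z) where
  open WellOrder Λ using (Carrier; isSTO)
  open Omega Λ
  open Consts z

  private
    module STO = IsStrictTotalOrder isSTO

  cmpΛ-refl : ∀ k → cmpΛ k k ≡ eq
  cmpΛ-refl k with STO.compare k k
  ... | tri< _ ¬e _ = ⊥-elim (¬e refl)
  ... | tri≈ _ _ _  = refl
  ... | tri> _ ¬e _ = ⊥-elim (¬e refl)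

  cmpΛ-eq : ∀ k l → cmpΛ k l ≡ eq → k ≡ l
  cmpΛ-eq k l e with STO.compare k l
  ... | tri≈ _ k≡l _ = k≡l

  cmpΛ-gt : ∀ k l → cmpΛ k l ≡ gt → WellOrder._<_ Λ l k
  cmpΛ-gt k l e with STO.compare k l
  ... | tri> _ _ l<k = l<k

  cmpΛ-lt : ∀ k l → cmpΛ k l ≡ lt → WellOrder._<_ Λ k l
  cmpΛ-lt k l e with STO.compare k l
  ... | tri< k<l _ _ = k<l

  <⇒cmpΛ-gt : ∀ k l → WellOrder._<_ Λ l k → cmpΛ k l ≡ gt
  <⇒cmpΛ-gt k l l<k with STO.compare k l
  ... | tri< _ _ ¬g = ⊥-elim (¬g l<k)
  ... | tri≈ _ _ ¬g = ⊥-elim (¬g l<k)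
  ... | tri> _ _ _  = refl

  cmpΛ-gt-trans : ∀ k l m → cmpΛ k l ≡ gt → cmpΛ l m ≡ gt → cmpΛ k m ≡ gt
  cmpΛ-gt-trans k l m p q = <⇒cmpΛ-gt k m (STO.trans (cmpΛ-gt l m q) (cmpΛ-gt k l p))

  cmpΛ-lt⇒gt : ∀ k l → cmpΛ k l ≡ lt → cmpΛ l k ≡ gt
  cmpΛ-lt⇒gt k l p = <⇒cmpΛ-gt l k (cmpΛ-lt k l p)

  cmpΛ-z≢gt : ∀ k → cmpΛ z k ≢ gt
  cmpΛ-z≢gt k e = z-min k (cmpΛ-gt z k e)

  exponent-gt : ∀ {k c xs l d ys} → cmpΛ k l ≡ gt → cmpExp ((k , c) ∷ xs) ((l , d) ∷ ys) ≡ gt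
  exponent-gt e rewrite e = refl

  coefficient-gt : ∀ {k c xs d ys} → cmpℕ c d ≡ gt → cmpExp ((k , c) ∷ xs) ((k , d) ∷ ys) ≡ gt
  coefficient-gt {k} e rewrite cmpΛ-refl k | e = refl

  tail-gt : ∀ {k c xs ys} → cmpExp xs ys ≡ gt → cmpExp ((k , c) ∷ xs) ((k , c) ∷ ys) ≡ gt
  tail-gt {k} {c} e rewrite cmpΛ-refl k | cmpℕ-refl c = e

  -- Records the first place where the larger exponent wins, so that inductions can match on that
  -- place.
  data GtView : Exp → Exp → Set where
    nonempty    : ∀ {x xs} → GtView (x ∷ xs) []
    exponent    : ∀ {k c xs l d ys} → cmpΛ k l ≡ gt → GtView ((k , c) ∷ xs) ((l , d) ∷ ys)
    coefficient : ∀ {k c xs d ys} → cmpℕ c d ≡ gt → GtView ((k , c) ∷ xs) ((k , d) ∷ ys)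
    tail        : ∀ {k c xs ys} → cmpExp xs ys ≡ gt → GtView ((k , c) ∷ xs) ((k , c) ∷ ys)

  gtView : ∀ a b → cmpExp a b ≡ gt → GtView a b
  gtView (_ ∷ _) [] _ = nonempty
  gtView ((k , c) ∷ xs) ((l , d) ∷ ys) e with cmpΛ k l in kl
  ... | gt = exponent kl
  ... | eq with cmpΛ-eq k l kl | cmpℕ c d in cd
  ...   | refl | gt = coefficient cd
  ...   | refl | eq with cmpℕ-eq c d cd
  ...     | refl = tail e

  -- Strict monotonicity of the sum of exponents in its right argument.

  addExp-identityˡ : ∀ b → addExp [] b ≡ b
  addExp-identityˡ []      = refl
  addExp-identityˡ (_ ∷ _) = refl

  addExp-eq : ∀ {k c xs d ys} →
    addExp ((k , c) ∷ xs) ((k , d) ∷ ys) ≡ (k , c + d + 1) ∷ ys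
  addExp-eq {k} rewrite cmpΛ-refl k = refl

  addExp-∷≢[] : ∀ a {b bs} → addExp a (b ∷ bs) ≢ []
  addExp-∷≢[] ((k , _) ∷ _) {l , _} e with cmpΛ k l
  addExp-∷≢[] ((k , _) ∷ _) {l , _} () | lt
  addExp-∷≢[] ((k , _) ∷ _) {l , _} () | eq
  addExp-∷≢[] ((k , _) ∷ _) {l , _} () | gt

  c+d+1-gt : ∀ c d → cmpℕ (c + d + 1) c ≡ gt
  c+d+1-gt zero    d rewrite +-comm d 1 = refl
  c+d+1-gt (suc c) d = c+d+1-gt c d

  addExp-increasing : ∀ a {b bs} → cmpExp (addExp a (b ∷ bs)) a ≡ gt
  addExp-increasing [] = refl
  addExp-increasing ((k , c) ∷ xs) {l , d} {bs} with cmpΛ k l in kl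
  ... | gt = tail-gt {k} {c} {addExp xs ((l , d) ∷ bs)} (addExp-increasing xs)
  ... | lt = exponent-gt {l} {d} {bs} {k} {c} {xs} (cmpΛ-lt⇒gt k l kl)
  ... | eq with cmpΛ-eq k l kl
  ...   | refl = coefficient-gt {k} {c + d + 1} {bs} (c+d+1-gt c d)

  -- The sums first differ either where `b` and `b'` do, or earlier, at a term of `a` that `b`
  -- absorbs or enlarges while it stands unchanged before `b'`.
  addExp-monoʳ : ∀ a {b b'} → GtView b b' → cmpExp (addExp a b) (addExp a b') ≡ gt
  addExp-monoʳ a nonempty = addExp-increasing a
  addExp-monoʳ [] (exponent {k} {c} {xs} e) = exponent-gt {k} {c} {xs} e
  addExp-monoʳ [] (coefficient {k} {c} {xs} e) = coefficient-gt {k} {c} {xs} e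
  addExp-monoʳ [] (tail {k} {c} {xs} e) = tail-gt {k} {c} {xs} e
  addExp-monoʳ ((k , c) ∷ xs) v@(exponent {l} {d} {ys} {l'} {d'} {ys'} e)
    with cmpΛ k l in kl | cmpΛ k l' in kl'
  ... | gt | gt = tail-gt {k} {c} {addExp xs ((l , d) ∷ ys)} (addExp-monoʳ xs v)
  -- A term of `a` that survives `b` also survives `b'`, as `k > l > l'`.
  ... | gt | eq = case trans (sym (cmpΛ-gt-trans k l l' kl e)) kl' of λ ()
  ... | gt | lt = case trans (sym (cmpΛ-gt-trans k l l' kl e)) kl' of λ ()
  ... | lt | lt = exponent-gt {l} {d} {ys} e
  ... | lt | eq = exponent-gt {l} {d} {ys} e
  ... | lt | gt = exponent-gt {l} {d} {ys} {k} {c} {addExp xs ((l' , d') ∷ ys')} (cmpΛ-lt⇒gt k l kl)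
  ... | eq | lt = exponent-gt {l} {c + d + 1} {ys} e
  ... | eq | eq = exponent-gt {l} {c + d + 1} {ys} e
  ... | eq | gt with cmpΛ-eq k l kl
  ...   | refl = coefficient-gt {k} {c + d + 1} {ys} (c+d+1-gt c d)
  addExp-monoʳ ((k , c) ∷ xs) v@(coefficient {l} {d} {ys} {d'} {ys'} e) with cmpΛ k l in kl
  ... | gt = tail-gt {k} {c} {addExp xs ((l , d) ∷ ys)} (addExp-monoʳ xs v)
  ... | eq = coefficient-gt {l} {c + d + 1} {ys}
               (trans (cmpℕ-+ʳ1 (c + d) (c + d')) (trans (cmpℕ-+ˡ c d d') e))
  ... | lt = coefficient-gt {l} {d} {ys} e
  addExp-monoʳ ((k , c) ∷ xs) v@(tail {l} {d} {ys} {ys'} e) with cmpΛ k l in kl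
  ... | gt = tail-gt {k} {c} {addExp xs ((l , d) ∷ ys)} (addExp-monoʳ xs v)
  ... | eq = tail-gt {l} {c + d + 1} {ys} e
  ... | lt = tail-gt {l} {d} {ys} e

  -- Multiplication in normal form.

  -- ((a , c) ∷ as) · β: no term is absorbed, because the exponents a + b strictly
  -- decrease along a well-formed β.
  mulC : Exp → ℕ → Raw → Raw → Raw
  mulC a c as []                = []
  mulC a c as (([] , d) ∷ β)    = (a , c + d + c * d) ∷ as
  mulC a c as ((b ∷ bs , d) ∷ β) = (addExp a (b ∷ bs) , d) ∷ mulC a c as β

  addRaw-gt : ∀ {a c b d β} → cmpExp a b ≡ gt →
    addRaw ((a , c) ∷ []) ((b , d) ∷ β) ≡ (a , c) ∷ (b , d) ∷ β
  addRaw-gt e rewrite e = refl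

  mulRaw≡mulC : ∀ a c as {β} → Decreasing cmpExp β → mulRaw ((a , c) ∷ as) β ≡ mulC a c as β
  mulRaw≡mulC a c as {[]} _ = refl
  mulRaw≡mulC a c as {([] , d) ∷ []} _ = refl
  -- A term with exponent 0 can only be the last one, since nothing lies below 0.
  mulRaw≡mulC a c as {([] , d) ∷ ([] , _) ∷ _} (() ∷ _)
  mulRaw≡mulC a c as {([] , d) ∷ (_ ∷ _ , _) ∷ _} (() ∷ _)
  mulRaw≡mulC a c as {(b ∷ bs , d) ∷ []} _ = refl
  mulRaw≡mulC a c as {(b ∷ bs , d) ∷ ([] , d') ∷ β} (e ∷ l)
    rewrite mulRaw≡mulC a c as l = addRaw-gt (addExp-increasing a)
  mulRaw≡mulC a c as {(b ∷ bs , d) ∷ (b' ∷ bs' , d') ∷ β} (e ∷ l)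
    rewrite mulRaw≡mulC a c as l = addRaw-gt (addExp-monoʳ a (gtView (b ∷ bs) (b' ∷ bs') e))

  mulRaw-zeroˡ : ∀ β → mulRaw [] β ≡ []
  mulRaw-zeroˡ []      = refl
  mulRaw-zeroˡ (_ ∷ β) rewrite mulRaw-zeroˡ β = refl

  -- Finite exponents.

  -- The natural number as an exponent ω^0 · n: `z` is the ordinal 0, and the stored coefficient is
  -- one less than its value.
  fin : ℕ → Exp
  fin zero    = []
  fin (suc k) = (z , k) ∷ []

  fin-injective : ∀ m n → fin m ≡ fin n → m ≡ n
  fin-injective zero    zero    _    = refl
  fin-injective (suc m) (suc n) refl = refl

  fin-+ : ∀ m n → addExp (fin m) (fin n) ≡ fin (m + n)
  fin-+ zero    n       = addExp-identityˡ (fin n)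
  fin-+ (suc m) zero    = cong (λ k → fin (suc k)) (sym (+-identityʳ m))
  fin-+ (suc m) (suc n) = trans addExp-eq
    (cong (λ k → (z , k) ∷ []) (trans (+-comm (m + n) 1) (sym (+-suc m n))))

  fin-gt : ∀ {m n} → n < m → cmpExp (fin m) (fin n) ≡ gt
  fin-gt {suc m} {zero}  _       = refl
  fin-gt {suc m} {suc n} (s≤s l) = coefficient-gt {z} {m} {[]} (<⇒cmpℕ-gt l)

  fin-wf : ∀ n → WFExp (fin n)
  fin-wf zero    = []
  fin-wf (suc n) = [-]

  after-z : ∀ {c xs} → WFExp ((z , c) ∷ xs) → xs ≡ []
  after-z [-]               = refl
  after-z {xs = (k , _) ∷ _} (e ∷ _) = ⊥-elim (cmpΛ-z≢gt k e)

  -- A term of `a` with key above `z` would remain in front of the added 1, but the sum is a single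
  -- term.
  fin-pred : ∀ a n → WFExp a → addExp a (fin 1) ≡ fin (suc n) → a ≡ fin n
  fin-pred [] zero _ e = refl
  fin-pred ((k , c) ∷ xs) n w e with cmpΛ k z in kz
  ... | gt = ⊥-elim (addExp-∷≢[] xs (∷-injectiveʳ e))
  ... | lt = ⊥-elim (z-min k (cmpΛ-lt k z kz))
  ... | eq with cmpΛ-eq k z kz
  ...   | refl with after-z w
  ...     | refl with e
  ...       | refl rewrite +-comm (c + 0) 1 | +-identityʳ c = refl

  -- As no key lies below `z`, the exponent `b` has at most one term, with key `z`.
  below-fin : ∀ n b → WFExp b → cmpExp (fin n) b ≡ gt → ∃ λ m → b ≡ fin m × m < n
  below-fin zero    []      _ ()
  below-fin zero    (_ ∷ _) _ ()
  below-fin (suc n) b w e with gtView (fin (suc n)) b e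
  ... | nonempty         = 0 , refl , s≤s z≤n
  ... | exponent {l = l} g = ⊥-elim (cmpΛ-z≢gt l g)
  ... | coefficient {d = d} g with after-z w
  ...   | refl = suc d , refl , s≤s (cmpℕ-gt⇒< n d g)
  below-fin (suc n) b w e | tail {ys = []} ()
  below-fin (suc n) b w e | tail {ys = _ ∷ _} ()

  -- Powers of ω and of ω^(n+1)+1.

  ωpow : ℕ → Raw
  ωpow k = (fin k , 0) ∷ []

  ωpow-injective : ∀ {m n} → ωpow m ≡ ωpow n → m ≡ n
  ωpow-injective {m} {n} e = fin-injective m n (cong proj₁ (∷-injectiveˡ e))

  ωpow-elt : ℕ → Elt
  ωpow-elt k = ωpow k , [-] , fin-wf k ∷ []

  -- geo n k = (ω^(n+1) + 1)^k = ω^(k(n+1)) + … + ω^(n+1) + 1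
  geoTail : ℕ → ℕ → Raw
  geoTail n zero    = []
  geoTail n (suc k) = (fin (k * suc n) , 0) ∷ geoTail n k

  geo : ℕ → ℕ → Raw
  geo n k = geoTail n (suc k)

  geo-decreasing : ∀ n k → Decreasing cmpExp (geo n k)
  geo-decreasing n zero    = [-]
  geo-decreasing n (suc k) = fin-gt {suc k * suc n} {k * suc n} (s≤s (m≤n+m (k * suc n) n)) ∷ geo-decreasing n k

  geo-wf : ∀ n k → WF (geo n k)
  geo-wf n k = geo-decreasing n k , all (suc k)
    where
    all : ∀ k → All (λ t → WFExp (proj₁ t)) (geoTail n k)
    all zero    = []
    all (suc k) = fin-wf (k * suc n) ∷ all k

  geo-elt : ℕ → ℕ → Elt
  geo-elt n k = geo n k , geo-wf n k

  -- Each term of positive exponent on the right gives one term, shifted by j(n+1); the last term 1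
  -- gives a copy of `geo n j`, which continues the progression of exponents.
  mulC-geo : ∀ n j k → mulC (fin (j * suc n)) 0 (geoTail n j) (geo n k) ≡ geo n (j + k)
  mulC-geo n j zero    = cong (geo n) (sym (+-identityʳ j))
  mulC-geo n j (suc k) = trans
    (cong₂ _∷_ (cong (_, 0) (trans (fin-+ (j * suc n) (suc k * suc n))
                                   (cong fin (trans (sym (*-distribʳ-+ (suc n) j (suc k)))
                                                    (cong (_* suc n) (+-suc j k))))))
               (mulC-geo n j k))
    (cong (geo n) (sym (+-suc j k)))

  mul-geo : ∀ n j k → mulRaw (geo n j) (geo n k) ≡ geo n (j + k)
  mul-geo n j k = trans (mulRaw≡mulC (fin (j * suc n)) 0 (geoTail n j) (geo-decreasing n k)) (mulC-geo n j k)

  -- Multiplying by ω from the right erases all but the degree and raises it by 1, so that equality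
  -- of degrees becomes an equation of the language.
  mul-geo-ω : ∀ n k → mulRaw (geo n k) ωR ≡ ωpow (suc (k * suc n))
  mul-geo-ω n k = cong (λ e → (e , 0) ∷ []) (trans (fin-+ (k * suc n) 1) (cong fin (+-comm (k * suc n) 1)))

  mul-ωpow-ω : ∀ k → mulRaw (ωpow k) ωR ≡ ωpow (suc k)
  mul-ωpow-ω k = cong (λ e → (e , 0) ∷ []) (trans (fin-+ k 1) (cong fin (+-comm k 1)))

  geo-degree : ∀ {m j n k} → mulRaw (geo m j) ωR ≡ mulRaw (geo n k) ωR → j * suc m ≡ k * suc n
  geo-degree {m} {j} {n} {k} e = suc-injective (ωpow-injective
    (trans (sym (mul-geo-ω m j)) (trans e (mul-geo-ω n k))))

  geo-injective : ∀ n j k → geo n j ≡ geo n k → j ≡ k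
  geo-injective n j k e = *-cancelʳ-≡ j k (suc n) (geo-degree {n} {j} {n} {k} (cong (λ x → mulRaw x ωR) e))

  geo-ω≢ : ∀ n k → mulRaw (geo n k) ωR ≢ geo n k
  geo-ω≢ n k e = 1+n≢n (fin-injective (suc (k * suc n)) (k * suc n)
    (cong proj₁ (∷-injectiveˡ (trans (sym (mul-geo-ω n k)) e))))

  powRaw-geo : ∀ j → powRaw ω+1R j ≡ geo 0 j
  powRaw-geo zero    = refl
  powRaw-geo (suc j) rewrite powRaw-geo j = trans (mul-geo 0 j 1) (cong (geo 0) (+-comm j 1))

  -- Ordinals commuting with ω^(n+1)+1.

  geo-commute : ∀ n k → mulRaw (geo n k) (geo n 1) ≡ mulRaw (geo n 1) (geo n k)
  geo-commute n k = trans (mul-geo n k 1) (trans (cong (geo n) (+-comm k 1)) (sym (mul-geo n 1 k)))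

  -- x·(ω^(n+1)+1) is x with one leading term added, and left multiplication
  -- by ω^(n+1)+1 shifts the exponents: so each term of x determines the previous one.
  shift⇒geo : ∀ n x A → mulC (fin (1 * suc n)) 0 (geoTail n 1) x ≡ (A , 0) ∷ x → ∃ λ k → x ≡ geo n k
  shift⇒geo n (([] , d) ∷ β) A e with ∷-injective e
  ... | e₁ , e₂ with ∷-injective e₂
  ...   | refl , refl = 0 , refl
  shift⇒geo n ((b ∷ bs , d) ∷ β) A e with ∷-injective e
  ... | e₁ , e₂ with cong proj₂ e₁
  ...   | refl with shift⇒geo n β (b ∷ bs) e₂
  ...     | k , refl = suc k , trans (sym e₂) (mulC-geo n 1 k)

  mul-geo1 : ∀ a c as n → mulRaw ((a , c) ∷ as) (geo n 1) ≡ (addExp a (fin (suc n)) , 0) ∷ (a , c) ∷ as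
  mul-geo1 a c as n = trans (mulRaw≡mulC a c as (geo-decreasing n 1))
    (cong₂ (λ k c → (addExp a (fin (suc k)) , 0) ∷ (a , c) ∷ as) (+-identityʳ n)
           (trans (cong₂ _+_ (+-identityʳ c) (*-zeroʳ c)) (+-identityʳ c)))

  -- Expanding both products turns commutation into the equation of `shift⇒geo`, with `A` the
  -- exponent of the added leading term.
  commute⇒geo : ∀ n x → Decreasing cmpExp x → x ≢ [] →
    mulRaw x (geo n 1) ≡ mulRaw (geo n 1) x → ∃ λ k → x ≡ geo n k
  commute⇒geo n [] _ x≢[] _ = ⊥-elim (x≢[] refl)
  commute⇒geo n x@((a , c) ∷ as) dec _ e = shift⇒geo n x (addExp a (fin (suc n)))
    (trans (sym (mulRaw≡mulC (fin (1 * suc n)) 0 (geoTail n 1) dec))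
    (trans (sym e) (mul-geo1 a c as n)))

  -- Irreducible ordinals of finite degree.

  -- A finite `w` must be 1, the leading coefficient being 1. If `w` has a single, infinite term,
  -- the product has one term instead of two. If `w` is an infinite term followed by a finite one,
  -- the end of the product is a multiple of `v` and must be 1, so `v` is 1. Two infinite terms
  -- would make the second exponent of the product positive.
  geo1-irreducible : ∀ n v w → Decreasing cmpExp w → geo n 1 ≡ mulRaw v w → v ≢ oneR → w ≢ oneR → ⊥
  geo1-irreducible n [] w _ e _ _ with trans e (mulRaw-zeroˡ w)
  ... | ()
  geo1-irreducible n ((a , c) ∷ as) w dec e v≢1 w≢1 = go w (trans e (mulRaw≡mulC a c as dec)) w≢1 dec
    where
    go : ∀ w → geo n 1 ≡ mulC a c as w → w ≢ oneR → Decreasing cmpExp w → ⊥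
    go (([] , d) ∷ []) e w≢1 _ =
      w≢1 (cong (λ d → ([] , d) ∷ []) (m+n≡0⇒n≡0 c (m+n≡0⇒m≡0 (c + d) (sym (cong proj₂ (∷-injectiveˡ e))))))
    go (([] , d) ∷ ([] , _) ∷ _) e w≢1 (() ∷ _)
    go (([] , d) ∷ (_ ∷ _ , _) ∷ _) e w≢1 (() ∷ _)
    go ((b ∷ bs , d) ∷ []) e w≢1 _ with ∷-injectiveʳ e
    ... | ()
    go ((b ∷ bs , d) ∷ ([] , d') ∷ β) e w≢1 _ with ∷-injective (∷-injectiveʳ e)
    ... | e₁ , e₂ = v≢1 (cong₂ _∷_ (cong₂ _,_ (sym (cong proj₁ e₁))
      (m+n≡0⇒m≡0 c (m+n≡0⇒m≡0 (c + d') (sym (cong proj₂ e₁))))) (sym e₂))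
    go ((b ∷ bs , d) ∷ (b' ∷ bs' , d') ∷ β) e w≢1 _ =
      addExp-∷≢[] a (sym (cong proj₁ (∷-injectiveˡ (∷-injectiveʳ e))))

  Irreducible : Raw → Set
  Irreducible y = (v w : Elt) → y ≡ mulRaw (proj₁ v) (proj₁ w) → proj₁ v ≢ oneR → proj₁ w ≢ oneR → ⊥

  setCoefficient-decreasing : ∀ {a c d} as → Decreasing cmpExp ((a , c) ∷ as) → Decreasing cmpExp ((a , d) ∷ as)
  setCoefficient-decreasing []      _       = [-]
  setCoefficient-decreasing (_ ∷ _) (e ∷ l) = e ∷ l

  -- The product with ω fixes the degree n+1. A leading coefficient above 1 splits off as a finite
  -- right factor, and a pure power of ω other than ω splits off ω. Otherwise y = ω^(n+1) + ρ, where
  -- ρ has degree m ≤ n and y = ρ · (ω^(n-m+1)+1), which forces ρ = 1.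
  irreducible⇒geo1 : ∀ n y → WF y → mulRaw y ωR ≡ ωpow (suc (suc n)) → y ≢ ωR → Irreducible y → y ≡ geo n 1
  irreducible⇒geo1 n ((a , c) ∷ as) (dec , wa ∷ was) e y≢ω irr
    with fin-pred a (suc n) wa (cong proj₁ (∷-injectiveˡ e))
  irreducible⇒geo1 n ((_ , suc c) ∷ as) (dec , wa ∷ was) e y≢ω irr | refl =
    -- The right factor is the integer c+2, stored as `suc c`.
    ⊥-elim (irr ((fin (suc n) , 0) ∷ as , setCoefficient-decreasing as dec , wa ∷ was)
                (([] , suc c) ∷ [] , [-] , [] ∷ [])
                (cong (λ c → (fin (suc n) , c) ∷ as) (sym (+-identityʳ (suc c))))
                (λ ()) (λ ()))
  irreducible⇒geo1 zero ((_ , zero) ∷ []) wf e y≢ω irr | refl = ⊥-elim (y≢ω refl)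
  irreducible⇒geo1 (suc n) ((_ , zero) ∷ []) wf e y≢ω irr | refl =
    ⊥-elim (irr (ωpow-elt (suc n)) (ωpow-elt 1) (sym (mul-ωpow-ω (suc n))) (λ ()) (λ ()))
  irreducible⇒geo1 n ((_ , zero) ∷ (b , d) ∷ bs) (g ∷ dec , wa ∷ wb ∷ wbs) e y≢ω irr | refl
    with below-fin (suc n) b wb g
  ... | m , refl , s≤s m≤n = remainder≡1 m d bs refl
    where
    -- Chosen so that m + (k+1) = n+1, the leading exponent of `y`.
    k = n ∸ m
    factored : (fin (suc n) , 0) ∷ (fin m , d) ∷ bs ≡ mulRaw ((fin m , d) ∷ bs) (geo k 1)
    factored = sym (trans (mul-geo1 (fin m) d bs k) (cong (λ e → (e , 0) ∷ _)
      (trans (fin-+ m (suc k)) (cong fin (trans (+-suc m k) (cong suc (m+[n∸m]≡n m≤n)))))))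

    reducible : (fin m , d) ∷ bs ≢ oneR → ⊥
    reducible ρ≢1 = irr ((fin m , d) ∷ bs , dec , wb ∷ wbs) (geo-elt k 1) factored ρ≢1 (λ ())

    -- The cases are taken on a copy of ρ tied to it by an equation, so that `reducible` still
    -- applies to ρ itself.
    remainder≡1 : ∀ m' d' bs' → (fin m' , d') ∷ bs' ≡ (fin m , d) ∷ bs →
      (fin (suc n) , 0) ∷ (fin m , d) ∷ bs ≡ geo n 1
    remainder≡1 zero    zero    []      e = cong₂ (λ k ρ → (fin (suc k) , 0) ∷ ρ) (sym (+-identityʳ n)) (sym e)
    remainder≡1 zero    zero    (_ ∷ _) e = ⊥-elim (reducible (λ e' → case trans e e' of λ ()))
    remainder≡1 zero    (suc _) _       e = ⊥-elim (reducible (λ e' → case trans e e' of λ ()))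
    remainder≡1 (suc _) _       _       e = ⊥-elim (reducible (λ e' → case trans e e' of λ ()))

  -- Renaming of variables and closure properties of definability.

  open Definability Λ z

  renT : ∀ {m n} → (Fin m → Fin n) → Term m → Term n
  renT f (var i) = var (f i)
  renT f (s ⊗ t) = renT f s ⊗ renT f t
  renT f c1      = c1
  renT f cω      = cω
  renT f cω+1    = cω+1
  renT f cω²+1   = cω²+1

  renQF : ∀ {m n} → (Fin m → Fin n) → QF m → QF n
  renQF f (s ≐ t)  = renT f s ≐ renT f t
  renQF f (¬' φ)   = ¬' (renQF f φ)
  renQF f (φ ∧' ψ) = renQF f φ ∧' renQF f ψ
  renQF f (φ ∨' ψ) = renQF f φ ∨' renQF f ψ

  module _ {m n} {f : Fin m → Fin n} {ρ : Fin m → Raw} {ρ' : Fin n → Raw} (ρ'f≡ρ : ∀ i → ρ' (f i) ≡ ρ i) where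

    evalT-ren : ∀ t → evalT ρ' (renT f t) ≡ evalT ρ t
    evalT-ren (var i) = ρ'f≡ρ i
    evalT-ren (s ⊗ t) = cong₂ mulRaw (evalT-ren s) (evalT-ren t)
    evalT-ren c1      = refl
    evalT-ren cω      = refl
    evalT-ren cω+1    = refl
    evalT-ren cω²+1   = refl

    -- Both directions go by one simultaneous induction, because negation exchanges them.
    Sat-ren⁻ : ∀ φ → Sat ρ' (renQF f φ) → Sat ρ φ
    Sat-ren⁺ : ∀ φ → Sat ρ φ → Sat ρ' (renQF f φ)

    Sat-ren⁻ (s ≐ t)  e        = trans (sym (evalT-ren s)) (trans e (evalT-ren t))
    Sat-ren⁻ (¬' φ)   ¬p       = ¬p ∘ Sat-ren⁺ φ
    Sat-ren⁻ (φ ∧' ψ) (p , q)  = Sat-ren⁻ φ p , Sat-ren⁻ ψ q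
    Sat-ren⁻ (φ ∨' ψ) (inj₁ p) = inj₁ (Sat-ren⁻ φ p)
    Sat-ren⁻ (φ ∨' ψ) (inj₂ q) = inj₂ (Sat-ren⁻ ψ q)

    Sat-ren⁺ (s ≐ t)  e        = trans (evalT-ren s) (trans e (sym (evalT-ren t)))
    Sat-ren⁺ (¬' φ)   ¬p       = ¬p ∘ Sat-ren⁻ φ
    Sat-ren⁺ (φ ∧' ψ) (p , q)  = Sat-ren⁺ φ p , Sat-ren⁺ ψ q
    Sat-ren⁺ (φ ∨' ψ) (inj₁ p) = inj₁ (Sat-ren⁺ φ p)
    Sat-ren⁺ (φ ∨' ψ) (inj₂ q) = inj₂ (Sat-ren⁺ ψ q)

  ++-factor : ∀ {A : Set} {m n k} {f : Fin m → Fin k} {g : Fin n → Fin k} {σ : Fin m → A} {τ : Fin n → A} {ρ : Fin k → A} →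
    (∀ i → ρ (f i) ≡ σ i) → (∀ i → ρ (g i) ≡ τ i) → ∀ i → ρ ((f ++ g) i) ≡ (σ ++ τ) i
  ++-factor {m = m} p q i with splitAt m i
  ... | inj₁ j = p j
  ... | inj₂ j = q j

  -- The free block moves by `f` and the existential block by `g`, while the six universal variables
  -- go to the six universal variables; so that block never grows.
  embed : ∀ {p m k} → (Fin p → Fin k) → (Fin m → Fin k) → Fin (p + m + 6) → Fin (k + 6)
  embed {k = k} f g = (λ i → (f ++ g) i ↑ˡ 6) ++ (k ↑ʳ_)

  embed-env : ∀ {p m k} (f : Fin p → Fin k) (g : Fin m → Fin k) {α : Fin p → Raw} {μ : Fin m → Raw} (ρ : Fin k → Raw) (v : Fin 6 → Raw) →
    (∀ i → ρ (f i) ≡ α i) → (∀ i → ρ (g i) ≡ μ i) → ∀ i → (ρ ++ v) (embed f g i) ≡ ((α ++ μ) ++ v) i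
  embed-env f g ρ v p q = ++-factor {ρ = ρ ++ v}
    (λ i → trans (lookup-++ˡ ρ v ((f ++ g) i)) (++-factor {f = f} {g} {ρ = ρ} p q i))
    (lookup-++ʳ ρ v)

  Rel : ℕ → Set₁
  Rel p = (Fin p → Elt) → Set

  definable-resp : ∀ {p} {R S : Rel p} → (∀ a → R a ⇔ S a) → Σ1-∀6-Definable R → Σ1-∀6-Definable S
  definable-resp R⇔S (m , φ , h) = m , φ , λ a → mk⇔
    (Equivalence.to (h a) ∘ Equivalence.from (R⇔S a)) (Equivalence.to (R⇔S a) ∘ Equivalence.from (h a))

  definable-qf : ∀ {p} (φ : QF p) → Σ1-∀6-Definable (λ a → Sat (raw a) φ)
  definable-qf {p} φ = 0 , renQF (λ i → (i ↑ˡ 0) ↑ˡ 6) φ , λ a → mk⇔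
    (λ s → (λ ()) , λ v → Sat-ren⁺ (agree a (λ ()) v) φ s)
    -- The universal block is vacuous here; it is instantiated at 1.
    (λ (u , s) → Sat-ren⁻ (agree a u (λ _ → ωpow-elt 0)) φ (s (λ _ → ωpow-elt 0)))
    where
    agree : ∀ a (u : Fin 0 → Elt) v i → ((raw a ++ raw u) ++ raw v) ((i ↑ˡ 0) ↑ˡ 6) ≡ raw a i
    agree a u v i = trans (lookup-++ˡ (raw a ++ raw u) (raw v) (i ↑ˡ 0)) (lookup-++ˡ (raw a) (raw u) i)

  definable-ren : ∀ {p q} (f : Fin p → Fin q) {R : Rel p} → Σ1-∀6-Definable R → Σ1-∀6-Definable (λ a → R (λ i → a (f i)))
  definable-ren {p} {q} f (m , φ , h) = m , renQF (embed (λ i → f i ↑ˡ m) (q ↑ʳ_)) φ , λ a → mk⇔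
    (λ r → let u , s = Equivalence.to (h _) r in u , λ v → Sat-ren⁺ (agree a u v) φ (s v))
    (λ (u , s) → Equivalence.from (h _) (u , λ v → Sat-ren⁻ (agree a u v) φ (s v)))
    where
    agree : ∀ a u v i → ((raw a ++ raw u) ++ raw v) (embed (λ i → f i ↑ˡ m) (q ↑ʳ_) i) ≡ ((raw (λ i → a (f i)) ++ raw u) ++ raw v) i
    agree a u v = embed-env (λ i → f i ↑ˡ m) (q ↑ʳ_) (raw a ++ raw u) (raw v) (λ i → lookup-++ˡ (raw a) (raw u) (f i)) (lookup-++ʳ (raw a) (raw u))

  -- The existential blocks are concatenated. The universal block is shared, since ∀ distributes
  -- over conjunction; this keeps the number of universal quantifiers at six.
  definable-∧ : ∀ {p} {R S : Rel p} → Σ1-∀6-Definable R → Σ1-∀6-Definable S → Σ1-∀6-Definable (λ a → R a × S a)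
  definable-∧ {p} (m , φ , h) (n , ψ , k) = m + n , renQF left φ ∧' renQF right ψ , λ a → mk⇔
    (λ (r , s) → let u , x = Equivalence.to (h a) r ; w , y = Equivalence.to (k a) s in
      u ++ w , λ v →
        Sat-ren⁺ (left-agree a u (u ++ w) v (λ i → cong proj₁ (lookup-++ˡ u w i))) φ (x v) ,
        Sat-ren⁺ (right-agree a w (u ++ w) v (λ i → cong proj₁ (lookup-++ʳ u w i))) ψ (y v))
    (λ (u , s) →
      Equivalence.from (h a) ((λ i → u (i ↑ˡ n)) , λ v → Sat-ren⁻ (left-agree a (λ i → u (i ↑ˡ n)) u v (λ _ → refl)) φ (proj₁ (s v))) ,
      Equivalence.from (k a) ((λ i → u (m ↑ʳ i)) , λ v → Sat-ren⁻ (right-agree a (λ i → u (m ↑ʳ i)) u v (λ _ → refl)) ψ (proj₂ (s v))))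
    where
    left : Fin (p + m + 6) → Fin (p + (m + n) + 6)
    left = embed (_↑ˡ (m + n)) (λ i → p ↑ʳ (i ↑ˡ n))
    right : Fin (p + n + 6) → Fin (p + (m + n) + 6)
    right = embed (_↑ˡ (m + n)) (λ i → p ↑ʳ (m ↑ʳ i))
    left-agree : ∀ a u u' v → (∀ i → raw u' (i ↑ˡ n) ≡ raw u i) → ∀ i → ((raw a ++ raw u') ++ raw v) (left i) ≡ ((raw a ++ raw u) ++ raw v) i
    left-agree a u u' v e = embed-env (_↑ˡ (m + n)) (λ i → p ↑ʳ (i ↑ˡ n)) (raw a ++ raw u') (raw v) (lookup-++ˡ (raw a) (raw u')) (λ i → trans (lookup-++ʳ (raw a) (raw u') (i ↑ˡ n)) (e i))
    right-agree : ∀ a w u' v → (∀ i → raw u' (m ↑ʳ i) ≡ raw w i) → ∀ i → ((raw a ++ raw u') ++ raw v) (right i) ≡ ((raw a ++ raw w) ++ raw v) i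
    right-agree a w u' v e = embed-env (_↑ˡ (m + n)) (λ i → p ↑ʳ (m ↑ʳ i)) (raw a ++ raw u') (raw v) (lookup-++ˡ (raw a) (raw u')) (λ i → trans (lookup-++ʳ (raw a) (raw u') (m ↑ʳ i)) (e i))

  definable-∃ : ∀ {p} {R : Rel (suc p)} → Σ1-∀6-Definable R → Σ1-∀6-Definable (λ a → Σ Elt λ x → R (x ∷ᶠ a))
  definable-∃ {p} (m , φ , h) = suc m , renQF move φ , λ a → mk⇔
    (λ (x , r) → let u , s = Equivalence.to (h _) r in x ∷ᶠ u , λ v → Sat-ren⁺ (agree a (x ∷ᶠ u) v) φ (s v))
    (λ (u , s) → u zero , Equivalence.from (h _) ((λ i → u (suc i)) , λ v → Sat-ren⁻ (agree a u v) φ (s v)))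
    where
    first : Fin (suc p) → Fin (p + suc m)
    first zero    = p ↑ʳ zero
    first (suc i) = i ↑ˡ suc m
    move : Fin (suc p + m + 6) → Fin (p + suc m + 6)
    move = embed first (λ i → p ↑ʳ suc i)
    agree : ∀ a u v i → ((raw a ++ raw u) ++ raw v) (move i) ≡ ((raw (u zero ∷ᶠ a) ++ raw (λ i → u (suc i))) ++ raw v) i
    agree a u v = embed-env first (λ i → p ↑ʳ suc i) (raw a ++ raw u) (raw v)
      (λ { zero → lookup-++ʳ (raw a) (raw u) zero ; (suc i) → lookup-++ˡ (raw a) (raw u) i })
      (λ i → lookup-++ʳ (raw a) (raw u) (suc i))

  -- Defining the graph of squaring.

  infixr 6 _and_
  _and_ : ∀ {n} → QF n → QF n → QF n
  _and_ = _∧'_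

  -- The ordinal 0 has no name in the language and commutes with everything; the second conjunct
  -- excludes it, as 0 is the only solution of t · ω = t.
  power : ∀ {n} → Term n → Term n → QF n
  power g t = ((t ⊗ g) ≐ (g ⊗ t)) and (¬' ((t ⊗ cω) ≐ t))

  IsPower : Raw → Raw → Set
  IsPower g x = mulRaw x g ≡ mulRaw g x × mulRaw x ωR ≢ x

  geo-isPower : ∀ n k → IsPower (geo n 1) (geo n k)
  geo-isPower n k = geo-commute n k , geo-ω≢ n k

  power⇒geo : ∀ n (x : Elt) → IsPower (geo n 1) (proj₁ x) → ∃ λ k → proj₁ x ≡ geo n k
  power⇒geo n (x , dec , _) (comm , xω≢x) = commute⇒geo n x dec (λ { refl → xω≢x refl }) comm

  -- Both k(i+1) and k(i+1) + k = k(i+2) are multiples of i+2, hence so is their difference k.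
  common-multiple : ∀ i k l → k * suc i ≡ l * suc (suc i) → ∃ λ t → k ≡ t * suc (suc i)
  common-multiple i k l e = quotient k∣ , _∣_.equality k∣
    where
    k∣ : suc (suc i) ∣ k
    k∣ = ∣m+n∣m⇒∣n (divides k (trans (+-comm (k * suc i) k) (sym (*-suc k (suc i))))) (divides l e)

  -- For x = (ω+1)^i this forces y₁ = ω^(i+1)+1, y₂ = ω^(i+2)+1 and P = y₁^(i+2), Q = y₂^(i+1),
  -- hence s = (ω+1)^(i²).
  square : QF 12
  square =
    power cω+1 x and power cω+1 s and
    ((y₁ ⊗ cω) ≐ ((x ⊗ cω) ⊗ cω)) and (¬' (y₁ ≐ cω)) and irreducible y₁ and
    ((y₂ ⊗ cω) ≐ (((x ⊗ cω) ⊗ cω) ⊗ cω)) and (¬' (y₂ ≐ cω)) and irreducible y₂ and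
    power y₁ P and power y₂ Q and ((P ⊗ cω) ≐ (Q ⊗ cω)) and (¬' (P ≐ c1)) and
    (¬' ((P ≐ (v₀ ⊗ v₂)) and power y₁ v₀ and power y₂ v₁ and power y₁ v₂ and
         ((v₀ ⊗ cω) ≐ (v₁ ⊗ cω)) and (¬' (v₀ ≐ c1)) and (¬' (v₂ ≐ c1)))) and
    (((((((s ⊗ x) ⊗ x) ⊗ x) ⊗ cω+1) ⊗ cω+1) ⊗ cω) ≐ (P ⊗ cω))
    where
    x  = var (# 0)
    s  = var (# 1)
    y₁ = var (# 2)
    y₂ = var (# 3)
    P  = var (# 4)
    Q  = var (# 5)
    v₀ = var (# 6)
    v₁ = var (# 7)
    v₂ = var (# 8)
    irreducible : Term 12 → QF 12
    irreducible y = ¬' ((y ≐ (v₀ ⊗ v₁)) and (¬' (v₀ ≐ c1)) and (¬' (v₁ ≐ c1)))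

  squareEnv : (x s y₁ y₂ P Q v₀ v₁ v₂ : Raw) → Fin 12 → Raw
  squareEnv x s y₁ y₂ P Q v₀ v₁ v₂ = lookup (x ∷ s ∷ y₁ ∷ y₂ ∷ P ∷ Q ∷ v₀ ∷ v₁ ∷ v₂ ∷ v₂ ∷ v₂ ∷ v₂ ∷ [])

  -- One factor ω reads off the degree i and the other raises it by 1, so that comparison with `y₁`
  -- times ω gives `y₁` degree i+1.
  geo0-ωω : ∀ i → mulRaw (mulRaw (geo 0 i) ωR) ωR ≡ ωpow (2 + i)
  geo0-ωω i = trans (cong (λ w → mulRaw w ωR) (mul-geo-ω 0 i))
    (trans (mul-ωpow-ω (1 + i * 1)) (cong (λ k → ωpow (2 + k)) (*-identityʳ i)))

  geo0-ωωω : ∀ i → mulRaw (mulRaw (mulRaw (geo 0 i) ωR) ωR) ωR ≡ ωpow (3 + i)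
  geo0-ωωω i = trans (cong (λ w → mulRaw w ωR) (geo0-ωω i)) (mul-ωpow-ω (2 + i))

  mul-geo1-ω : ∀ n → mulRaw (geo n 1) ωR ≡ ωpow (2 + n)
  mul-geo1-ω n = trans (mul-geo-ω n 1) (cong (λ k → ωpow (2 + k)) (+-identityʳ n))

  geo0-product : ∀ q i →
    mulRaw (mulRaw (mulRaw (mulRaw (mulRaw (geo 0 q) (geo 0 i)) (geo 0 i)) (geo 0 i)) ω+1R) ω+1R
      ≡ geo 0 (q + i + i + i + 1 + 1)
  geo0-product q i
    rewrite mul-geo 0 q i | mul-geo 0 (q + i) i | mul-geo 0 (q + i + i) i
          | mul-geo 0 (q + i + i + i) 1 = mul-geo 0 (q + i + i + i + 1) 1

  geo-common-degree : ∀ i → mulRaw (geo i (2 + i)) ωR ≡ mulRaw (geo (suc i) (1 + i)) ωR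
  geo-common-degree i = trans (mul-geo-ω i (2 + i))
    (trans (cong (λ k → ωpow (suc k)) (*-comm (2 + i) (1 + i))) (sym (mul-geo-ω (suc i) (1 + i))))

  square-complete : ∀ i (v₀ v₁ v₂ : Elt) →
    Sat (squareEnv (geo 0 i) (geo 0 (i * i)) (geo i 1) (geo (suc i) 1) (geo i (2 + i)) (geo (suc i) (1 + i))
                   (proj₁ v₀) (proj₁ v₁) (proj₁ v₂)) square
  square-complete i v₀ v₁ v₂ =
    geo-isPower 0 i , geo-isPower 0 (i * i) ,
    trans (mul-geo1-ω i) (sym (geo0-ωω i)) , (λ ()) , irreducible i ,
    trans (mul-geo1-ω (suc i)) (sym (geo0-ωωω i)) , (λ ()) , irreducible (suc i) ,
    geo-isPower i (2 + i) , geo-isPower (suc i) (1 + i) ,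
    geo-common-degree i ,
    (λ ()) , minimal ,
    -- The degree of s · x^3 · (ω+1)^2 is i^2 + 3i + 2 = (i+2)(i+1), that of `P`.
    trans (cong (λ w → mulRaw w ωR) (geo0-product (i * i) i))
      (trans (mul-geo-ω 0 (i * i + i + i + i + 1 + 1))
        (trans (cong (λ k → ωpow (suc k)) (degree i)) (sym (mul-geo-ω i (2 + i)))))
    where
    degree : ∀ i → (i * i + i + i + i + 1 + 1) * 1 ≡ (2 + i) * (1 + i)
    degree = solve-∀

    irreducible : ∀ n → ¬ (geo n 1 ≡ mulRaw (proj₁ v₀) (proj₁ v₁) × proj₁ v₀ ≢ oneR × proj₁ v₁ ≢ oneR)
    irreducible n (e , v₀≢1 , v₁≢1) = geo1-irreducible n (proj₁ v₀) (proj₁ v₁) (proj₁ (proj₂ v₁)) e v₀≢1 v₁≢1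

    minimal : ¬ (geo i (2 + i) ≡ mulRaw (proj₁ v₀) (proj₁ v₂) ×
      IsPower (geo i 1) (proj₁ v₀) × IsPower (geo (suc i) 1) (proj₁ v₁) × IsPower (geo i 1) (proj₁ v₂) ×
      mulRaw (proj₁ v₀) ωR ≡ mulRaw (proj₁ v₁) ωR × proj₁ v₀ ≢ oneR × proj₁ v₂ ≢ oneR)
    minimal (e , p₀ , p₁ , p₂ , d , v₀≢1 , v₂≢1)
      with power⇒geo i v₀ p₀ | power⇒geo (suc i) v₁ p₁ | power⇒geo i v₂ p₂
    -- As `v₀` shares its degree with a power of ω^(i+2)+1, its exponent `k` is a multiple of i+2.
    -- If `k` is zero then `v₀` is 1; otherwise `v₀` exhausts `P` and `v₂` is 1.
    ... | k , e₀ | l , e₁ | m , e₂ with common-multiple i k l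
            (geo-degree {i} {k} {suc i} {l} (subst₂ (λ x y → mulRaw x ωR ≡ mulRaw y ωR) e₀ e₁ d))
    ...   | zero , refl  = v₀≢1 e₀
    ...   | suc t , refl = v₂≢1 (trans e₂ (cong (geo i) m≡0))
      where
      m≡0 : m ≡ 0
      m≡0 = m+n≡0⇒n≡0 (t * (2 + i)) (+-cancelˡ-≡ (2 + i) (t * (2 + i) + m) 0
        (trans (sym (+-assoc (2 + i) (t * (2 + i)) m))
        (trans (sym (geo-injective i (2 + i) (suc t * (2 + i) + m)
                      (trans e (trans (cong₂ mulRaw e₀ e₂) (mul-geo i (suc t * (2 + i)) m)))))
               (sym (+-identityʳ (2 + i))))))

  one : Elt
  one = ωpow-elt 0

  square-sound : ∀ (x s y₁ y₂ P Q : Elt) →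
    ((v₀ v₁ v₂ : Elt) → Sat (squareEnv (proj₁ x) (proj₁ s) (proj₁ y₁) (proj₁ y₂) (proj₁ P) (proj₁ Q)
                                       (proj₁ v₀) (proj₁ v₁) (proj₁ v₂)) square) →
    ∃ λ i → proj₁ x ≡ geo 0 i × proj₁ s ≡ geo 0 (i * i)
  square-sound (x , wx) (s , ws) (y₁ , wy₁) (y₂ , wy₂) (P , wP) (Q , wQ) h
    -- The conjuncts free of `v₀`, `v₁`, `v₂` are read off at one instance; the universal ones are
    -- instantiated where they are needed.
    with h one one one
  ... | px , ps , d₁ , y₁≢ω , _ , d₂ , y₂≢ω , _ , pP , pQ , dPQ , P≢1 , _ , ds
    with power⇒geo 0 (x , wx) px | power⇒geo 0 (s , ws) ps
  ... | i , refl | q , refl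
    with irreducible⇒geo1 i y₁ wy₁ (trans d₁ (geo0-ωω i)) y₁≢ω
           (λ v w e v≢1 w≢1 → let _ , _ , _ , _ , irr , _ = h v w one in irr (e , v≢1 , w≢1))
       | irreducible⇒geo1 (suc i) y₂ wy₂ (trans d₂ (geo0-ωωω i)) y₂≢ω
           (λ v w e v≢1 w≢1 → let _ , _ , _ , _ , _ , _ , _ , irr , _ = h v w one in irr (e , v≢1 , w≢1))
  ... | refl | refl
    with power⇒geo i (P , wP) pP | power⇒geo (suc i) (Q , wQ) pQ
  ... | k , refl | l , refl
    with common-multiple i k l (geo-degree {i} {k} {suc i} {l} dPQ)
  ... | zero , refl        = ⊥-elim (P≢1 refl)
  ... | suc zero , refl    = i , refl , cong (geo 0) (q≡i² (geo-degree {0} {q + i + i + i + 1 + 1} {i} {1 * (2 + i)}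
          (trans (cong (λ w → mulRaw w ωR) (sym (geo0-product q i))) ds)))
    where
    degreeˡ : ∀ q i → q + (i + i + i + 2) ≡ (q + i + i + i + 1 + 1) * 1
    degreeˡ = solve-∀
    degreeʳ : ∀ i → 1 * (2 + i) * (1 + i) ≡ i * i + (i + i + i + 2)
    degreeʳ = solve-∀
    q≡i² : (q + i + i + i + 1 + 1) * 1 ≡ 1 * (2 + i) * (1 + i) → q ≡ i * i
    q≡i² e = +-cancelʳ-≡ (i + i + i + 2) q (i * i) (trans (degreeˡ q i) (trans e (degreeʳ i)))
  -- With exponent (t+2)(i+2), `P` splits as y₁^(i+2) · y₁^((t+1)(i+2)). The first factor already
  -- has the degree of y₂^(i+1), against minimality.
  ... | suc (suc t) , refl = ⊥-elim (minimal
          (sym (mul-geo i (2 + i) (suc t * (2 + i))) , geo-isPower i (2 + i) , geo-isPower (suc i) (1 + i) ,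
           geo-isPower i (suc t * (2 + i)) ,
           geo-common-degree i ,
           (λ ()) , (λ ())))
    where
    minimal = let _ , _ , _ , _ , _ , _ , _ , _ , _ , _ , _ , _ , min , _ =
                    h (geo-elt i (2 + i)) (geo-elt (suc i) (1 + i)) (geo-elt i (suc t * (2 + i))) in min

  -- Definable relations between exponents.

  OnPowers : ∀ {p} → ((Fin p → ℕ) → Set) → Rel p
  OnPowers S a = Σ (Fin _ → ℕ) λ j → (∀ i → raw a i ≡ geo 0 (j i)) × S j

  -- Exponents recovered from two conjuncts agree only pointwise, by `geo0-unique`; `extensional`
  -- carries `S` from one tuple to the other.
  record PowerDefinable {p : ℕ} (S : (Fin p → ℕ) → Set) : Set where
    field
      extensional : ∀ {j k} → (∀ i → j i ≡ k i) → S j → S k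
      definable   : Σ1-∀6-Definable (OnPowers S)
  open PowerDefinable

  square-definable : PowerDefinable {2} (λ j → j (# 1) ≡ j (# 0) * j (# 0))
  square-definable .extensional e s = trans (sym (e (# 1))) (trans s (cong₂ _*_ (e (# 0)) (e (# 0))))
  -- The four existential variables are `y₁`, `y₂`, `P` and `Q`.
  square-definable .definable = 4 , square , λ a → mk⇔
    (λ (j , pw , s) → witnesses (j (# 0)) , λ v →
      subst₂ (λ x y → Sat (squareEnv x y _ _ _ _ _ _ _) square) (sym (pw (# 0)))
        (sym (trans (pw (# 1)) (cong (geo 0) s))) (square-complete (j (# 0)) (v (# 0)) (v (# 1)) (v (# 2))))
    (λ (u , s) → let i , e₀ , e₁ = square-sound (a (# 0)) (a (# 1)) (u (# 0)) (u (# 1)) (u (# 2)) (u (# 3))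
                                     (λ v₀ v₁ v₂ → s (lookup (v₀ ∷ v₁ ∷ v₂ ∷ v₂ ∷ v₂ ∷ v₂ ∷ []))) in
      lookup (i ∷ i * i ∷ []) , (λ { zero → e₀ ; (suc zero) → e₁ }) , refl)
    where
    witnesses : ℕ → Fin 4 → Elt
    witnesses i = lookup (geo-elt i 1 ∷ geo-elt (suc i) 1 ∷ geo-elt i (2 + i) ∷ geo-elt (suc i) (1 + i) ∷ [])

  conjunction : ∀ {n} p → (Fin p → QF n) → QF n
  conjunction zero    φ = c1 ≐ c1
  conjunction (suc p) φ = φ zero and conjunction p (φ ∘ suc)

  Sat-conjunction⁺ : ∀ {n} {ρ : Fin n → Raw} p {φ : Fin p → QF n} → (∀ i → Sat ρ (φ i)) → Sat ρ (conjunction p φ)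
  Sat-conjunction⁺ zero    s = refl
  Sat-conjunction⁺ (suc p) s = s zero , Sat-conjunction⁺ p (s ∘ suc)

  Sat-conjunction⁻ : ∀ {n} {ρ : Fin n → Raw} p {φ : Fin p → QF n} → Sat ρ (conjunction p φ) → ∀ i → Sat ρ (φ i)
  Sat-conjunction⁻ (suc p) (s , _)  zero    = s
  Sat-conjunction⁻ (suc p) (_ , ss) (suc i) = Sat-conjunction⁻ p ss i

  geo0-unique : ∀ {x j k} → x ≡ geo 0 j → x ≡ geo 0 k → j ≡ k
  geo0-unique {j = j} {k} e e' = geo-injective 0 j k (trans (sym e) e')

  powers-definable : ∀ {p} → Σ1-∀6-Definable (OnPowers {p} (λ _ → ⊤))
  powers-definable {p} = definable-resp
    (λ a → mk⇔
      (λ s → let pw i = power⇒geo 0 (a i) (Sat-conjunction⁻ p s i) in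
        (λ i → proj₁ (pw i)) , (λ i → proj₂ (pw i)) , tt)
      (λ (j , pw , _) → Sat-conjunction⁺ p (λ i → subst (IsPower ω+1R) (sym (pw i)) (geo-isPower 0 (j i)))))
    (definable-qf (conjunction p (λ i → power cω+1 (var i))))

  pd-resp : ∀ {p} {S T : (Fin p → ℕ) → Set} → (∀ j → S j ⇔ T j) → PowerDefinable S → PowerDefinable T
  pd-resp h d .extensional e t = Equivalence.to (h _) (d .extensional e (Equivalence.from (h _) t))
  pd-resp h d .definable = definable-resp
    (λ a → mk⇔ (λ (j , pw , s) → j , pw , Equivalence.to (h j) s) (λ (j , pw , t) → j , pw , Equivalence.from (h j) t))
    (d .definable)

  -- `powers-definable` is conjoined as a guard, so `φ` has to be correct only on powers of ω+1.
  pd-qf : ∀ {p} (φ : QF p) {S : (Fin p → ℕ) → Set} → (∀ {j k} → (∀ i → j i ≡ k i) → S j → S k) →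
    (∀ a j → (∀ i → raw a i ≡ geo 0 (j i)) → Sat (raw a) φ ⇔ S j) → PowerDefinable S
  pd-qf φ ext h .extensional = ext
  pd-qf φ ext h .definable = definable-resp
    (λ a → mk⇔ (λ ((j , pw , _) , s) → j , pw , Equivalence.to (h a j pw) s)
               (λ (j , pw , s) → (j , pw , tt) , Equivalence.from (h a j pw) s))
    (definable-∧ powers-definable (definable-qf φ))

  -- Arguments outside the image of `f` must be powers too, whence the additional guard.
  pd-ren : ∀ {p q} (f : Fin p → Fin q) {S : (Fin p → ℕ) → Set} → PowerDefinable S → PowerDefinable (λ j → S (λ i → j (f i)))
  pd-ren f d .extensional e = d .extensional (λ i → e (f i))
  pd-ren f d .definable = definable-resp
    (λ a → mk⇔ (λ ((j , pw , _) , (k , pw' , s)) →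
                  j , pw , d .extensional (λ i → geo0-unique (pw' i) (pw (f i))) s)
               (λ (j , pw , s) → (j , pw , tt) , (λ i → j (f i)) , (λ i → pw (f i)) , s))
    (definable-∧ powers-definable (definable-ren f (d .definable)))

  pd-∧ : ∀ {p} {S T : (Fin p → ℕ) → Set} → PowerDefinable S → PowerDefinable T → PowerDefinable (λ j → S j × T j)
  pd-∧ d d' .extensional e (s , t) = d .extensional e s , d' .extensional e t
  pd-∧ d d' .definable = definable-resp
    (λ a → mk⇔ (λ ((j , pw , s) , (k , pw' , t)) →
                  j , pw , s , d' .extensional (λ i → geo0-unique (pw' i) (pw i)) t)
               (λ (j , pw , s , t) → (j , pw , s) , (j , pw , t)))
    (definable-∧ (d .definable) (d' .definable))

  pd-∃ : ∀ {p} {S : (Fin (suc p) → ℕ) → Set} → PowerDefinable S → PowerDefinable (λ j → ∃ λ n → S (n ∷ᶠ j))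
  pd-∃ d .extensional e (n , s) = n , d .extensional (λ { zero → refl ; (suc i) → e i }) s
  pd-∃ d .definable = definable-resp
    (λ a → mk⇔ (λ (x , j , pw , s) → (λ i → j (suc i)) , (λ i → pw (suc i)) , j zero ,
                  d .extensional (λ { zero → refl ; (suc i) → refl }) s)
               (λ (j , pw , n , s) → geo-elt 0 n , (n ∷ᶠ j) , (λ { zero → refl ; (suc i) → pw i }) , s))
    (definable-∃ (d .definable))

  sumN : ∀ {p} → List (Fin p) → (Fin p → ℕ) → ℕ
  sumN []       j = 0
  sumN (i ∷ is) j = j i + sumN is j

  sumT : ∀ {p} → List (Fin p) → Term p
  sumT []       = c1
  sumT (i ∷ is) = var i ⊗ sumT is

  evalT-sum : ∀ {p} (is : List (Fin p)) {a : Fin p → Elt} {j} → (∀ i → raw a i ≡ geo 0 (j i)) →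
    evalT (raw a) (sumT is) ≡ geo 0 (sumN is j)
  evalT-sum []       pw = refl
  evalT-sum (i ∷ is) {a} {j} pw = trans (cong₂ mulRaw (pw i) (evalT-sum is {a} pw)) (mul-geo 0 (j i) (sumN is j))

  sumN-ext : ∀ {p} (is : List (Fin p)) {j k} → (∀ i → j i ≡ k i) → sumN is j ≡ sumN is k
  sumN-ext []       e = refl
  sumN-ext (i ∷ is) e = cong₂ _+_ (e i) (sumN-ext is e)

  -- Multiplying powers of ω+1 adds their exponents, so one equation with a product suffices.
  sum-definable : ∀ {p} (i : Fin p) (is : List (Fin p)) → PowerDefinable (λ j → j i ≡ sumN is j)
  sum-definable i is = pd-qf (var i ≐ sumT is)
    (λ e s → trans (sym (e i)) (trans s (sumN-ext is e)))
    (λ a j pw → mk⇔ (λ s → geo0-unique (pw i) (trans s (evalT-sum is {a} pw)))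
                    (λ s → trans (pw i) (trans (cong (geo 0) s) (sym (evalT-sum is {a} pw)))))

  one-definable : PowerDefinable {1} (λ j → j zero ≡ 1)
  one-definable = pd-qf (var zero ≐ cω+1) (λ e s → trans (sym (e zero)) s)
    (λ a j pw → mk⇔ (geo0-unique {k = 1} (pw zero)) (λ s → trans (pw zero) (cong (geo 0) s)))

  -- From squaring to Diophantine equations.

  -- From squares to products by (a + b)² = a² + b² + 2ab.
  product-definable : PowerDefinable {3} (λ j → j (# 0) ≡ j (# 1) * j (# 2))
  product-definable = pd-resp
    (λ j → mk⇔
      (λ (a² , b² , a+b , c² , ea , eb , es , ec , e) → polarise (j (# 0)) (j (# 1)) (j (# 2)) ea eb es ec e)
      (λ e → let a = j (# 1) ; b = j (# 2) in
        a * a , b * b , a + b , (a + b) * (a + b) , refl , refl , cong (a +_) (sym (+-identityʳ b)) , refl ,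
        trans (expand a b) (cong (λ c → a * a + (b * b + (c + (c + 0)))) (sym e))))
    -- Each quantifier puts its variable in front: the indices 0 to 6 are (a+b)^2, a+b, b^2, a^2,
    -- the product, a and b.
    (pd-∃ (pd-∃ (pd-∃ (pd-∃
      (pd-∧ (pd-ren (lookup (# 5 ∷ # 3 ∷ [])) square-definable)
      (pd-∧ (pd-ren (lookup (# 6 ∷ # 2 ∷ [])) square-definable)
      (pd-∧ (sum-definable (# 1) (# 5 ∷ # 6 ∷ []))
      (pd-∧ (pd-ren (lookup (# 1 ∷ # 0 ∷ [])) square-definable)
            (sum-definable {7} (# 0) (# 3 ∷ # 2 ∷ # 4 ∷ # 4 ∷ []))))))))))
    where
    expand : ∀ a b → (a + b) * (a + b) ≡ a * a + (b * b + (a * b + (a * b + 0)))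
    expand = solve-∀
    polarise : ∀ c a b {a² b² a+b c²} → a² ≡ a * a → b² ≡ b * b → a+b ≡ a + (b + 0) → c² ≡ a+b * a+b →
      c² ≡ a² + (b² + (c + (c + 0))) → c ≡ a * b
    polarise c a b refl refl refl refl e rewrite +-identityʳ b =
      *-cancelˡ-≡ c (a * b) 2 (+-cancelˡ-≡ (b * b) (2 * c) (2 * (a * b))
        (+-cancelˡ-≡ (a * a) (b * b + 2 * c) (b * b + 2 * (a * b)) (trans (sym e) (expand a b))))

  -- The values of the two subterms become existentially quantified exponents, so nesting of terms
  -- lengthens the existential block only.
  graph-binary : ∀ {p} (_∙_ : ℕ → ℕ → ℕ) (s t : NTerm p) →
    PowerDefinable {3} (λ j → j (# 0) ≡ j (# 1) ∙ j (# 2)) →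
    PowerDefinable (λ j → j zero ≡ evalN (λ i → j (suc i)) s) →
    PowerDefinable (λ j → j zero ≡ evalN (λ i → j (suc i)) t) →
    PowerDefinable (λ j → j zero ≡ evalN (λ i → j (suc i)) s ∙ evalN (λ i → j (suc i)) t)
  graph-binary {p} _∙_ s t op ds dt = pd-resp
    (λ j → mk⇔ (λ { (_ , _ , refl , refl , e) → e }) (λ e → _ , _ , refl , refl , e))
    (pd-∃ (pd-∃ (pd-∧ (pd-ren (at (# 1)) ds) (pd-∧ (pd-ren (at (# 0)) dt) (pd-ren (lookup (# 2 ∷ # 1 ∷ # 0 ∷ [])) op)))))
    where
    at : Fin (3 + p) → Fin (suc p) → Fin (3 + p)
    at r zero    = r
    at r (suc i) = suc (suc (suc i))

  graph-definable : ∀ {p} (t : NTerm p) → PowerDefinable (λ j → j zero ≡ evalN (λ i → j (suc i)) t)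
  graph-definable (var i) = pd-resp (λ j → mk⇔ (λ e → trans e (+-identityʳ _)) (λ e → trans e (sym (+-identityʳ _))))
    (sum-definable zero (suc i ∷ []))
  graph-definable (s ⊕ t) = graph-binary _+_ s t
    (pd-resp (λ j → mk⇔ (λ e → trans e (cong (j (# 1) +_) (+-identityʳ _))) (λ e → trans e (cong (j (# 1) +_) (sym (+-identityʳ _)))))
      (sum-definable (# 0) (# 1 ∷ # 2 ∷ [])))
    (graph-definable s) (graph-definable t)
  graph-definable (s ⊛ t) = graph-binary _*_ s t product-definable (graph-definable s) (graph-definable t)
  graph-definable n0      = sum-definable zero []
  graph-definable n1      = pd-ren (λ _ → zero) one-definable

  equation-definable : ∀ {p} (E : Atomic p) → PowerDefinable (Holds E)
  equation-definable (s ≐ℕ t) = pd-resp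
    (λ j → mk⇔ (λ (_ , e , e') → trans (sym e) e') (λ e → _ , refl , e))
    (pd-∃ (pd-∧ (graph-definable s) (graph-definable t)))

  InEQ-definable : ∀ {p} (E : Atomic p) → Σ1-∀6-Definable (InEQ E)
  InEQ-definable E = definable-resp
    (λ a → mk⇔ (λ (j , pw , h) → j , (λ i → trans (pw i) (sym (powRaw-geo (j i)))) , h)
               (λ (j , pw , h) → j , (λ i → trans (pw i) (powRaw-geo (j i))) , h))
    (equation-definable E .definable)

mainTheorem10 : (Λ : WellOrder) → (z : WellOrder.Carrier Λ) →
    ((x : WellOrder.Carrier Λ) → ¬ WellOrder._<_ Λ x z) →
    Σ (WellOrder.Carrier Λ) (WellOrder._<_ Λ z) →
    {p : ℕ} → (E : Atomic p) →
    Definability.Σ1-∀6-Definable Λ z (Definability.InEQ Λ z E)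
mainTheorem10 Λ z z-min _ = InEQ-definable Λ z z-min
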